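{- In the unweighted offline setting, no EF1 scheduling algorithm can achieve a price of fairness strictly smaller than $\tfrac32$: for every offline EF1 scheduling algorithm $\mathrm{ALG}$ (taking the number of machines and the instance as input) and every $\alpha<\tfrac32$ there exist a number of machines $m$ and an instance $\mathcal I$ with $|\mathrm{OPT}(\mathcal I)|>\alpha\,|\mathrm{ALG}(\mathcal I)|$. Specifically, for every $m\ge 2$ there is an instance $\mathcal I$ of unit-weight intervals on $m$ identical machines such that every EF1 schedule $S$ of $\mathcal I$ satisfies $$|\mathrm{OPT}(\mathcal I)|\;\ge\;\frac{3m-2}{2m-1}\,|S| .$$
   Context: An instance $\mathcal I$ is a finite indexed family of intervals $I_1,\dots,I_n$ (identical intervals may occur several times). Interval $I_j$ has a start time $s_j$ and an end time $e_j$, $s_j<e_j$, both nonnegative rationals, and is identified with the half-open set $[s_j,e_j)$. Two intervals overlap (conflict) if these sets intersect. Unweighted means every interval has weight $1$. Machines are $1,\dots,m$. A schedule assigns a subset of the intervals to machines (each accepted interval to exactly one machine; intervals may be left unassigned) so that no two intervals on the same machine overlap. $S_i$ is the set of intervals assigned to machine $i$, and the size $|\cdot|$ of a schedule is its number of assigned intervals. $\mathrm{OPT}(\mathcal I)$ is a schedule of maximum size on the $m$ machines, with no fairness requirement. A schedule is EF1 (envy-free up to one interval) if for every pair of machines $i\ne k$ with $S_k\neq\emptyset$ there is $I\in S_k$ such that $u(S_i)\ge u(S_k)-w(I)$, where $u(S)$ is the total weight of $S$; with unit weights this says $|S_i|\ge |S_k|-1$. An offline EF1 scheduling algorithm is any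 map sending $m$ and an instance (given in full in advance) to an EF1 schedule of it on $m$ machines. Its price of fairness is the smallest $\alpha$ such that $|\mathrm{OPT}(\mathcal I)|\le\alpha|\mathrm{ALG}(\mathcal I)|$ for every instance, the worst case being over all instances and all numbers of machines. -}

module Defs where

open import Data.Fin.Base using (Fin)
import Data.Fin.Properties as Fin
open import Data.Fin.Subset using (Subset; _∈_; ∣_∣; Nonempty)
open import Data.Integer.Base using (+_)
open import Data.Maybe.Base using (Maybe; just; is-just)
open import Data.Maybe.Properties using (≡-dec)
open import Data.Nat.Base as ℕ using (ℕ; _∸_; NonZero; s≤s)
open import Data.Product.Base using (∃; _×_; Σ)
open import Data.Rational.Base using (ℚ; 0ℚ; _≤_; _<_; _/_)
open import Data.Vec.Base using (tabulate)
open import Data.Vec.Functional using (Vector)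
open import Level using (0ℓ)
open import Relation.Binary.PropositionalEquality.Core using (_≡_; _≢_)
open import Relation.Nullary.Decidable.Core using (does)
open import Relation.Nullary.Negation.Core using (¬_)
open import Relation.Unary using (Pred; _≬_)

record Interval : Set where
  field
    start end   : ℚ
    start≥0     : 0ℚ ≤ start
    start<end   : start < end

-- The half-open set [start , end).  Rational points suffice: two such sets
-- with rational endpoints meet in ℝ iff they meet in ℚ (at the larger start).
⟦_⟧ : Interval → Pred ℚ 0ℓ
⟦ I ⟧ x = start ≤ x × x < end
  where open Interval I

Overlap : Interval → Interval → Set
Overlap I J = ⟦ I ⟧ ≬ ⟦ J ⟧

record Instance : Set where
  field
    n        : ℕ
    interval : Vector Interval n

record Schedule (m : ℕ) (𝓘 : Instance) : Set where
  open Instance 𝓘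
  field
    -- nothing means that the interval is left unassigned
    assign     : Fin n → Maybe (Fin m)
    noConflict : ∀ {j k i} → j ≢ k → assign j ≡ just i → assign k ≡ just i →
                 ¬ Overlap (interval j) (interval k)

  onMachine : Fin m → Subset n
  onMachine i = tabulate λ j → does (≡-dec Fin._≟_ (assign j) (just i))

  assigned : Subset n
  assigned = tabulate λ j → is-just (assign j)

  size : ℕ
  size = ∣ assigned ∣

open Schedule public using (onMachine; size)

-- All weights are 1: the utility u is cardinality, and w(j) = 1 is what is
-- subtracted (∸ does not truncate, as onMachine S k is nonempty).
EF1 : ∀ {m 𝓘} → Schedule m 𝓘 → Set
EF1 S = ∀ i k → i ≢ k → Nonempty (onMachine S k) →
        ∃ λ j → j ∈ onMachine S k × ∣ onMachine S i ∣ ℕ.≥ ∣ onMachine S k ∣ ∸ 1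

EF1Algorithm : Set
EF1Algorithm = ∀ m 𝓘 → Σ (Schedule m 𝓘) EF1

IsOptimal : ∀ {m 𝓘} → Schedule m 𝓘 → Set
IsOptimal {m} {𝓘} S = ∀ (T : Schedule m 𝓘) → size T ℕ.≤ size S

fromℕ : ℕ → ℚ
fromℕ k = + k / 1

2m∸1≢0 : ∀ {m} → m ℕ.≥ 2 → NonZero (2 ℕ.* m ∸ 1)
2m∸1≢0 (s≤s (s≤s _)) = _

ratio : ∀ m → m ℕ.≥ 2 → ℚ
ratio m m≥2 = + (3 ℕ.* m ∸ 2) / (2 ℕ.* m ∸ 1)
  where instance _ = 2m∸1≢0 m≥2

{-# OPTIONS --safe #-}

-- Take m ∸ 1 copies of [0 , 2m ∸ 1) together with the 2m ∸ 1 unit intervals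
-- [t , t + 1) inside it.  Everything fits on m machines, so the optimum is
-- 3m ∸ 2.  A long interval conflicts with every other interval, so a machine
-- running one runs nothing else; by EF1 every other machine then has at most
-- two intervals, 1 + 2 (m ∸ 1) in total.  Without long intervals there are
-- only the 2m ∸ 1 short ones.
module Submission where

open import Defs
open import Data.Fin.Base as Fin using (Fin; zero; suc; toℕ; _↑ˡ_; _↑ʳ_; splitAt; punchOut)
import Data.Fin.Properties as Fin
open import Data.Fin.Subset using (Subset; inside; outside; ∣_∣; ⊥; ⊤; _∈_; _∪_; ⁅_⁆)
open import Data.Fin.Subset.Properties
  using (∣⊥∣≡0; ∣⊤∣≡n; ∣p∣≤n; ∣⁅x⁆∣≡1; x∈⁅x⁆; p⊆q⇒∣p∣≤∣q∣; p⊆p∪q; q⊆p∪q; nonempty?; Empty-unique; _∈?_)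
open import Data.Integer.Base as ℤ using (+_; -[1+_]; -<+; +<+; +≤+)
import Data.Integer.Properties as ℤ
open import Data.Maybe.Base using (just; nothing)
open import Data.Maybe.Properties using (≡-dec; just-injective)
open import Data.Nat.Base as ℕ using (ℕ; zero; suc; _∸_; z≤n; s≤s)
import Data.Nat.Properties as ℕ
open import Data.Nat.Tactic.RingSolver using (solve-∀)
open import Data.Product.Base using (Σ; ∃; _×_; _,_; proj₁; proj₂)
open import Data.Rational.Base using (ℚ; mkℚ; _<_; _≤_; _≥_; _>_; _*_; _/_; toℚᵘ; fromℚᵘ; ↥_; ↧_; ↧ₙ_; *<*)
import Data.Rational.Properties as ℚ
open import Data.Rational.Unnormalised.Base as ℚᵘ using (mkℚᵘ)
import Data.Rational.Unnormalised.Properties as ℚᵘ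
open import Data.Sum.Base using (_⊎_; inj₁; inj₂; [_,_])
open import Data.Vec.Base using ([]; _∷_; tabulate)
open import Data.Vec.Functional as Vector using (Vector; removeAt)
open import Data.Vec.Properties using (lookup∘tabulate; []=⇒lookup; lookup⇒[]=)
open import Function.Base using (_∘_; const)
open import Relation.Binary.Definitions using (tri<; tri≈; tri>)
open import Relation.Binary.PropositionalEquality
  using (_≡_; _≢_; refl; sym; trans; cong; subst; subst₂)
open import Relation.Nullary.Decidable using (yes; no; dec-true)
open import Relation.Nullary.Negation using (¬_; contradiction)

private variable
  m n : ℕ

-- Cardinality of finite unions.

∣p∪q∣≤∣p∣+∣q∣ : ∀ (p q : Subset n) → ∣ p ∪ q ∣ ℕ.≤ ∣ p ∣ ℕ.+ ∣ q ∣
∣p∪q∣≤∣p∣+∣q∣ []            []            = z≤n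
∣p∪q∣≤∣p∣+∣q∣ (outside ∷ p) (outside ∷ q) = ∣p∪q∣≤∣p∣+∣q∣ p q
∣p∪q∣≤∣p∣+∣q∣ (outside ∷ p) (inside  ∷ q) =
  ℕ.≤-trans (s≤s (∣p∪q∣≤∣p∣+∣q∣ p q)) (ℕ.≤-reflexive (sym (ℕ.+-suc ∣ p ∣ ∣ q ∣)))
∣p∪q∣≤∣p∣+∣q∣ (inside  ∷ p) (outside ∷ q) = s≤s (∣p∪q∣≤∣p∣+∣q∣ p q)
∣p∪q∣≤∣p∣+∣q∣ (inside  ∷ p) (inside  ∷ q) =
  s≤s (ℕ.≤-trans (∣p∪q∣≤∣p∣+∣q∣ p q) (ℕ.+-monoʳ-≤ ∣ p ∣ (ℕ.n≤1+n ∣ q ∣)))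

⋃ : Vector (Subset n) m → Subset n
⋃ = Vector.foldr _∪_ ⊥

∈⋃ : ∀ (ps : Vector (Subset n) m) i {x} → x ∈ ps i → x ∈ ⋃ ps
∈⋃ {m = suc _} ps zero    x∈p = p⊆p∪q (⋃ (ps ∘ suc)) x∈p
∈⋃ {m = suc _} ps (suc i) x∈p = q⊆p∪q (ps zero) _ (∈⋃ (ps ∘ suc) i x∈p)

∣⋃∣≤ : ∀ {c} (ps : Vector (Subset n) m) → (∀ i → ∣ ps i ∣ ℕ.≤ c) → ∣ ⋃ ps ∣ ℕ.≤ m ℕ.* c
∣⋃∣≤ {n} {zero}  ps ≤c = ℕ.≤-reflexive (∣⊥∣≡0 n)
∣⋃∣≤ {n} {suc m} ps ≤c = ℕ.≤-trans (∣p∪q∣≤∣p∣+∣q∣ (ps zero) _)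
                           (ℕ.+-mono-≤ (≤c zero) (∣⋃∣≤ (ps ∘ suc) (≤c ∘ suc)))

-- Comparing fractions by cross-multiplication.

-- Since `+ a / suc d` is `fromℚᵘ (mkℚᵘ (+ a) d)`, this moves inequalities of fractions to
-- unnormalised rationals, where they are integer inequalities and no gcd has to be computed.
fromℚᵘ-mono-≤ : ∀ x y → x ℚᵘ.≤ y → fromℚᵘ x ≤ fromℚᵘ y
fromℚᵘ-mono-≤ x y x≤y = ℚ.toℚᵘ-cancel-≤
  (ℚᵘ.≤-respʳ-≃ (ℚᵘ.≃-sym (ℚ.toℚᵘ-fromℚᵘ y)) (ℚᵘ.≤-respˡ-≃ (ℚᵘ.≃-sym (ℚ.toℚᵘ-fromℚᵘ x)) x≤y))

fromℚᵘ-mono-< : ∀ x y → x ℚᵘ.< y → fromℚᵘ x < fromℚᵘ y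
fromℚᵘ-mono-< x y x<y = ℚ.toℚᵘ-cancel-<
  (ℚᵘ.<-respʳ-≃ (ℚᵘ.≃-sym (ℚ.toℚᵘ-fromℚᵘ y)) (ℚᵘ.<-respˡ-≃ (ℚᵘ.≃-sym (ℚ.toℚᵘ-fromℚᵘ x)) x<y))

fromℚᵘ-homo-* : ∀ x y → fromℚᵘ (x ℚᵘ.* y) ≡ fromℚᵘ x * fromℚᵘ y
fromℚᵘ-homo-* x y = ℚ.toℚᵘ-injective (begin-equality
  toℚᵘ (fromℚᵘ (x ℚᵘ.* y))            ≃⟨ ℚ.toℚᵘ-fromℚᵘ (x ℚᵘ.* y) ⟩
  x ℚᵘ.* y                            ≃⟨ ℚᵘ.*-cong (ℚ.toℚᵘ-fromℚᵘ x) (ℚ.toℚᵘ-fromℚᵘ y) ⟨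
  toℚᵘ (fromℚᵘ x) ℚᵘ.* toℚᵘ (fromℚᵘ y) ≃⟨ ℚ.toℚᵘ-homo-* (fromℚᵘ x) (fromℚᵘ y) ⟨
  toℚᵘ (fromℚᵘ x * fromℚᵘ y)          ∎)
  where open ℚᵘ.≤-Reasoning

fromℕ-mono-≤ : ∀ {j k} → j ℕ.≤ k → fromℕ j ≤ fromℕ k
fromℕ-mono-≤ {j} {k} j≤k = fromℚᵘ-mono-≤ (mkℚᵘ (+ j) 0) (mkℚᵘ (+ k) 0) (ℚᵘ.*≤* (ℤ.*-monoʳ-≤-nonNeg (+ 1) (+≤+ j≤k)))

fromℕ-mono-< : ∀ {j k} → j ℕ.< k → fromℕ j < fromℕ k
fromℕ-mono-< {j} {k} j<k = fromℚᵘ-mono-< (mkℚᵘ (+ j) 0) (mkℚᵘ (+ k) 0) (ℚᵘ.*<* (ℤ.*-monoʳ-<-pos (+ 1) (+<+ j<k)))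

fromℕ≥0 : ∀ k → fromℕ 0 ≤ fromℕ k
fromℕ≥0 k = fromℕ-mono-≤ {0} {k} z≤n

-- Cross-multiplied, the claim is `a * s ≤ a * suc d`. It serves the explicit ratio, with `a` the
-- optimum and `suc d` the bound on EF1 schedules.
fraction*≤ : ∀ a d {s} → s ℕ.≤ suc d → (+ a / suc d) * fromℕ s ≤ fromℕ a
fraction*≤ a d {s} s≤1+d = subst (_≤ fromℕ a) (fromℚᵘ-homo-* (mkℚᵘ (+ a) d) (mkℚᵘ (+ s) 0))
  (fromℚᵘ-mono-≤ (mkℚᵘ (+ a) d ℚᵘ.* mkℚᵘ (+ s) 0) (mkℚᵘ (+ a) 0) (ℚᵘ.*≤* (begin
    + a ℤ.* + s ℤ.* + 1         ≡⟨ ℤ.*-identityʳ (+ a ℤ.* + s) ⟩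
    + a ℤ.* + s                 ≤⟨ ℤ.*-monoˡ-≤-nonNeg (+ a) (+≤+ s≤1+d) ⟩
    + a ℤ.* + suc d             ≡⟨ cong (λ e → + a ℤ.* + e) (ℕ.*-identityʳ (suc d)) ⟨
    + a ℤ.* + (suc d ℕ.* 1)     ∎)))
  where open ℤ.≤-Reasoning

α*<-cross : ∀ α s t → ↥ α ℤ.* + s ℤ.< + t ℤ.* ↧ α → α * fromℕ s < fromℕ t
α*<-cross α@record{} s t cross =
  subst (_< fromℕ t) (trans (fromℚᵘ-homo-* (toℚᵘ α) (mkℚᵘ (+ s) 0)) (cong (_* fromℕ s) (ℚ.fromℚᵘ-toℚᵘ α)))
  (fromℚᵘ-mono-< (toℚᵘ α ℚᵘ.* mkℚᵘ (+ s) 0) (mkℚᵘ (+ t) 0) (ℚᵘ.*<* (begin-strict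
    ↥ α ℤ.* + s ℤ.* + 1              ≡⟨ ℤ.*-identityʳ (↥ α ℤ.* + s) ⟩
    ↥ α ℤ.* + s                      <⟨ cross ⟩
    + t ℤ.* ↧ α                      ≡⟨ cong (λ e → + t ℤ.* + e) (ℕ.*-identityʳ (↧ₙ α)) ⟨
    + t ℤ.* + (↧ₙ α ℕ.* 1)           ∎)))
  where open ℤ.≤-Reasoning

-- Machines of a schedule and EF1.

module _ {𝓘 : Instance} (S : Schedule m 𝓘) where
  open Schedule S using (assign; assigned)

  ∈onMachine⁺ : ∀ {i j} → assign j ≡ just i → j ∈ onMachine S i
  ∈onMachine⁺ {i} {j} eq = lookup⇒[]= j _
    (trans (lookup∘tabulate _ j) (dec-true (≡-dec Fin._≟_ (assign j) (just i)) eq))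

  ∈onMachine⁻ : ∀ {i j} → j ∈ onMachine S i → assign j ≡ just i
  ∈onMachine⁻ {i} {j} j∈
    with ≡-dec Fin._≟_ (assign j) (just i) | trans (sym (lookup∘tabulate _ j)) ([]=⇒lookup j∈)
  ... | yes eq | _ = eq
  ... | no  _  | ()

  ∈assigned⁻ : ∀ {j} → j ∈ assigned → ∃ λ i → assign j ≡ just i
  ∈assigned⁻ {j} j∈ with assign j | trans (sym (lookup∘tabulate _ j)) ([]=⇒lookup j∈)
  ... | just i  | _ = i , refl
  ... | nothing | ()

  -- `EF1` speaks only of nonempty machines `k`; an empty one satisfies the bound trivially.
  EF1⇒∣onMachine∣≤ : EF1 S → ∀ {i k} → i ≢ k → ∣ onMachine S k ∣ ℕ.≤ suc ∣ onMachine S i ∣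
  EF1⇒∣onMachine∣≤ ef1 {i} {k} i≢k with nonempty? (onMachine S k)
  ... | yes k≢∅ = ℕ.≤-trans (ℕ.m≤n+m∸n _ 1) (s≤s (proj₂ (proj₂ (ef1 i k i≢k k≢∅))))
  ... | no  k≡∅ = ℕ.≤-trans (ℕ.≤-reflexive (trans (cong ∣_∣ (Empty-unique k≡∅)) (∣⊥∣≡0 (Instance.n 𝓘)))) z≤n

-- The instance and its optimum.

-- p = m ∸ 1 long intervals and q = 2m ∸ 1 short ones, for m = suc p machines.
module LongShort (p : ℕ) where

  q : ℕ
  q = 1 ℕ.+ p ℕ.* 2

  [_,_⟩ : ∀ j {k} → j ℕ.< k → Interval
  [_,_⟩ j {k} j<k = record
    { start   = fromℕ j
    ; end     = fromℕ k
    ; start≥0 = fromℕ≥0 j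
    ; start<end = fromℕ-mono-< {j} {k} j<k
    }

  long : Interval
  -- The right endpoint is implicit: `z<s` proves `0 < 1 + p * 2`, so the interval ends at `q`.
  long = [ 0 , ℕ.z<s {n = p ℕ.* 2} ⟩

  short : ℕ → Interval
  short t = [ t , ℕ.n<1+n t ⟩

  long-overlaps : Overlap long long
  long-overlaps = fromℕ 0 , 0∈long , 0∈long
    where
    0∈long : ⟦ long ⟧ (fromℕ 0)
    0∈long = ℚ.≤-refl , Interval.start<end long

  long-overlaps-short : ∀ (t : Fin q) → Overlap long (short (toℕ t))
  long-overlaps-short t = fromℕ (toℕ t) , (fromℕ≥0 (toℕ t) , fromℕ-mono-< {toℕ t} {q} (Fin.toℕ<n t)) ,
                          (ℚ.≤-refl , Interval.start<end (short (toℕ t)))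

  -- A common point `x` would satisfy `x < 1 + t ≤ u ≤ x`; half-openness makes the first inequality
  -- strict.
  short-disjoint-< : ∀ {t u} → t ℕ.< u → ¬ Overlap (short t) (short u)
  short-disjoint-< {t} {u} t<u (x , (_ , x<1+t) , (u≤x , _)) =
    ℚ.<-irrefl refl (ℚ.<-≤-trans x<1+t (ℚ.≤-trans (fromℕ-mono-≤ {suc t} {u} t<u) u≤x))

  short-disjoint : ∀ {t u} → t ≢ u → ¬ Overlap (short t) (short u)
  short-disjoint {t} {u} t≢u (x , x∈t , x∈u) with ℕ.<-cmp t u
  ... | tri< t<u _ _ = short-disjoint-< {t} {u} t<u (x , x∈t , x∈u)
  ... | tri≈ _ t≡u _ = t≢u t≡u
  ... | tri> _ _ u<t = short-disjoint-< u<t (x , x∈u , x∈t)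

  interval : Fin p ⊎ Fin q → Interval
  interval = [ const long , short ∘ toℕ ]

  𝓘 : Instance
  𝓘 = record { n = p ℕ.+ q ; interval = interval ∘ splitAt p }

  -- The long copies take one machine each, which leaves exactly one for the pairwise disjoint short
  -- intervals.
  machine : Fin p ⊎ Fin q → Fin (suc p)
  machine = [ suc , const zero ]

  -- A long and a short interval never share a machine, as `suc j` is not `zero`, so only the two
  -- pure cases remain.
  sameMachine-disjoint : ∀ a b → a ≢ b → machine a ≡ machine b → ¬ Overlap (interval a) (interval b)
  sameMachine-disjoint (inj₁ j) (inj₁ k) a≢b eq = contradiction (cong inj₁ (Fin.suc-injective eq)) a≢b
  sameMachine-disjoint (inj₂ t) (inj₂ u) a≢b eq = short-disjoint (a≢b ∘ cong inj₂ ∘ Fin.toℕ-injective)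

  OPT : Schedule (suc p) 𝓘
  OPT = record
    { assign     = just ∘ machine ∘ splitAt p
    ; noConflict = λ {j} {k} j≢k j↦i k↦i →
        sameMachine-disjoint (splitAt p j) (splitAt p k)
          (λ eq → j≢k (trans (sym (Fin.join-splitAt p q j))
                        (trans (cong (Fin.join p q) eq) (Fin.join-splitAt p q k))))
          (just-injective (trans j↦i (sym k↦i)))
    }

  size-OPT : size OPT ≡ p ℕ.+ q
  size-OPT = trans (cong ∣_∣ (tabulate-const (p ℕ.+ q))) (∣⊤∣≡n (p ℕ.+ q))
    where
    tabulate-const : ∀ k → tabulate {n = k} (const inside) ≡ ⊤
    tabulate-const zero    = refl
    tabulate-const (suc k) = cong (inside ∷_) (tabulate-const k)

  -- `OPT` accepts every interval.
  OPT-optimal : IsOptimal OPT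
  OPT-optimal T = ℕ.≤-trans (∣p∣≤n (Schedule.assigned T)) (ℕ.≤-reflexive (sym size-OPT))

  long-overlaps-all : ∀ (j : Fin p) k → Overlap (Instance.interval 𝓘 (j ↑ˡ q)) (Instance.interval 𝓘 k)
  long-overlaps-all j k rewrite Fin.splitAt-↑ˡ p j q with splitAt p k
  ... | inj₁ _ = long-overlaps
  ... | inj₂ t = long-overlaps-short t

  -- Upper bound on EF1 schedules.

  module _ (S : Schedule (suc p) 𝓘) where
    open Schedule S using (assign; noConflict; assigned)

    ∣longMachine∣≤1 : ∀ {j i} → assign (j ↑ˡ q) ≡ just i → ∣ onMachine S i ∣ ℕ.≤ 1
    ∣longMachine∣≤1 {j} {i} j↦i = ℕ.≤-trans (p⊆q⇒∣p∣≤∣q∣ alone) (ℕ.≤-reflexive (∣⁅x⁆∣≡1 (j ↑ˡ q)))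
      where
      alone : ∀ {k} → k ∈ onMachine S i → k ∈ ⁅ j ↑ˡ q ⁆
      alone {k} k∈i with (j ↑ˡ q) Fin.≟ k
      ... | yes refl = x∈⁅x⁆ _
      ... | no  j≢k  = contradiction (long-overlaps-all j k) (noConflict j≢k j↦i (∈onMachine⁻ S k∈i))

    size≤-long : EF1 S → ∀ {j i} → assign (j ↑ˡ q) ≡ just i → size S ℕ.≤ q
    size≤-long ef1 {j} {i} j↦i = begin
      ∣ assigned ∣                       ≤⟨ p⊆q⇒∣p∣≤∣q∣ covered ⟩
      ∣ onMachine S i ∪ ⋃ others ∣       ≤⟨ ∣p∪q∣≤∣p∣+∣q∣ (onMachine S i) (⋃ others) ⟩
      ∣ onMachine S i ∣ ℕ.+ ∣ ⋃ others ∣ ≤⟨ ℕ.+-mono-≤ i≤1 (∣⋃∣≤ others others≤2) ⟩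
      1 ℕ.+ p ℕ.* 2                      ∎
      where
      open ℕ.≤-Reasoning
      i≤1 : ∣ onMachine S i ∣ ℕ.≤ 1
      i≤1 = ∣longMachine∣≤1 j↦i
      -- Removing machine `i` from the family leaves `p` machines, so the bounds add up to
      -- `1 + p * 2`, which is `q`.
      others : Vector (Subset (p ℕ.+ q)) p
      others = removeAt (onMachine S) i
      others≤2 : ∀ k → ∣ others k ∣ ℕ.≤ 2
      others≤2 k = ℕ.≤-trans (EF1⇒∣onMachine∣≤ S ef1 (Fin.punchInᵢ≢i i k ∘ sym)) (s≤s i≤1)
      covered : ∀ {x} → x ∈ assigned → x ∈ onMachine S i ∪ ⋃ others
      covered {x} x∈ with ∈assigned⁻ S x∈
      ... | k , x↦k with i Fin.≟ k
      ...   | yes refl = p⊆p∪q _ (∈onMachine⁺ S x↦k)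
      -- `punchOut` renumbers machine `k` within the family without `i`.
      ...   | no  i≢k  = q⊆p∪q _ _ (∈⋃ others (punchOut i≢k)
                (subst (λ l → x ∈ onMachine S l) (sym (Fin.punchIn-punchOut i≢k)) (∈onMachine⁺ S x↦k)))

    size≤-short : (∀ j → ¬ (j ↑ˡ q ∈ assigned)) → size S ℕ.≤ q
    size≤-short noLong = begin
      ∣ assigned ∣  ≤⟨ p⊆q⇒∣p∣≤∣q∣ covered ⟩
      ∣ ⋃ shorts ∣  ≤⟨ ∣⋃∣≤ shorts (λ t → ℕ.≤-reflexive (∣⁅x⁆∣≡1 (p ↑ʳ t))) ⟩
      q ℕ.* 1       ≡⟨ ℕ.*-identityʳ q ⟩
      q             ∎
      where
      open ℕ.≤-Reasoning
      shorts : Vector (Subset (p ℕ.+ q)) q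
      shorts t = ⁅ p ↑ʳ t ⁆
      covered : ∀ {x} → x ∈ assigned → x ∈ ⋃ shorts
      covered {x} x∈ with splitAt p x in eq
      ... | inj₁ j = contradiction (subst (_∈ assigned) (sym (Fin.splitAt⁻¹-↑ˡ eq)) x∈) (noLong j)
      ... | inj₂ t = ∈⋃ shorts t (subst (_∈ shorts t) (Fin.splitAt⁻¹-↑ʳ eq) (x∈⁅x⁆ _))

    size≤ : EF1 S → size S ℕ.≤ q
    size≤ ef1 with Fin.any? (λ j → j ↑ˡ q ∈? assigned)
    ... | yes (_ , j∈) = size≤-long ef1 (proj₂ (∈assigned⁻ S j∈))
    ... | no  noLong   = size≤-short (λ j j∈ → noLong (j , j∈))

-- The two ratios.

open LongShort using (𝓘; OPT; OPT-optimal; size-OPT; size≤)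

-- For α = n / d ≥ 0 the choice p = n works because α < 3/2 gives 1 + 2 n ≤ 3 d,
-- hence n (2 p + 1) ≤ 3 p d < (3 p + 1) d.
α*q<p+q : ∀ α → α < + 3 / 2 → let p = ℤ.∣ ↥ α ∣ in
          ∀ {s} → s ℕ.≤ 1 ℕ.+ p ℕ.* 2 → α * fromℕ s < fromℕ (p ℕ.+ (1 ℕ.+ p ℕ.* 2))
α*q<p+q α@(mkℚ (+ n) d-1 _) (*<* 2n<3d) {s} s≤q =
  α*<-cross α s t (subst₂ ℤ._<_ (ℤ.pos-* n s) (ℤ.pos-* t d) (+<+ (begin-strict
  n ℕ.* s                          ≤⟨ ℕ.*-monoʳ-≤ n s≤q ⟩
  n ℕ.* (1 ℕ.+ n ℕ.* 2)            ≤⟨ ℕ.*-monoʳ-≤ n 1+2n≤3d ⟩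
  -- Strictness comes from the summand `d`, which is positive.
  n ℕ.* (3 ℕ.* d)                  <⟨ ℕ.m<m+n _ (ℕ.z<s {n = d-1}) ⟩
  n ℕ.* (3 ℕ.* d) ℕ.+ d            ≡⟨ expand n d ⟩
  t ℕ.* d                          ∎)))
  where
  open ℕ.≤-Reasoning
  d t : ℕ
  d = suc d-1
  t = n ℕ.+ (1 ℕ.+ n ℕ.* 2)
  1+2n≤3d : 1 ℕ.+ n ℕ.* 2 ℕ.≤ 3 ℕ.* d
  1+2n≤3d = ℤ.drop‿+<+ (subst (ℤ._< + (3 ℕ.* d)) (sym (ℤ.pos-* n 2)) 2n<3d)
  expand : ∀ n d → n ℕ.* (3 ℕ.* d) ℕ.+ d ≡ (n ℕ.+ (1 ℕ.+ n ℕ.* 2)) ℕ.* d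
  expand = solve-∀
-- For negative `α` the left side is zero if `s` is zero and negative otherwise, while the right
-- side is positive.
α*q<p+q α@(mkℚ -[1+ n ] d-1 _) _ {zero}  _ = α*<-cross α 0 (suc n ℕ.+ (1 ℕ.+ suc n ℕ.* 2)) lemma
  where
  lemma : -[1+ n ] ℤ.* + 0 ℤ.< + ((suc n ℕ.+ (1 ℕ.+ suc n ℕ.* 2)) ℕ.* suc d-1)
  lemma rewrite ℕ.*-zeroʳ n = +<+ ℕ.z<s
α*q<p+q α@(mkℚ -[1+ n ] _ _) _ {suc s} _ = α*<-cross α (suc s) (suc n ℕ.+ (1 ℕ.+ suc n ℕ.* 2)) -<+

-- For `m = suc p` neither subtraction truncates: `3m = 2 + (3p + 1)` and `2m = 1 + (2p + 1)`. The
-- ratio is thus the size of `OPT` over `q`.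
ratio-suc : ∀ p (1+p≥2 : suc p ℕ.≥ 2) → ratio (suc p) 1+p≥2 ≡ + (p ℕ.+ (1 ℕ.+ p ℕ.* 2)) / (1 ℕ.+ p ℕ.* 2)
ratio-suc p 1+p≥2 = ℚ./-cong (cong +_ (cong (_∸ 2) (numerator p))) (cong (_∸ 1) (denominator p))
  where
  instance _ = 2m∸1≢0 1+p≥2
  numerator : ∀ p → 3 ℕ.* suc p ≡ 2 ℕ.+ (p ℕ.+ (1 ℕ.+ p ℕ.* 2))
  numerator = solve-∀
  denominator : ∀ p → 2 ℕ.* suc p ≡ 1 ℕ.+ (1 ℕ.+ p ℕ.* 2)
  denominator = solve-∀

theorem2 : ((ALG : EF1Algorithm) (α : ℚ) → α < + 3 / 2 →
    Σ ℕ λ m → Σ Instance λ 𝓘 → Σ (Schedule m 𝓘) λ OPT →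
    IsOptimal OPT × fromℕ (size OPT) > α * fromℕ (size (proj₁ (ALG m 𝓘))))
    ×
    ((m : ℕ) (m≥2 : m ℕ.≥ 2) →
    Σ Instance λ 𝓘 → Instance.n 𝓘 ℕ.> 0 × Σ (Schedule m 𝓘) λ OPT →
    IsOptimal OPT ×
    ((S : Schedule m 𝓘) → EF1 S → fromℕ (size OPT) ≥ ratio m m≥2 * fromℕ (size S)))
theorem2 = belowThreeHalves , bound
  where
  belowThreeHalves : (ALG : EF1Algorithm) (α : ℚ) → α < + 3 / 2 →
    Σ ℕ λ m → Σ Instance λ 𝓘 → Σ (Schedule m 𝓘) λ OPT →
    IsOptimal OPT × fromℕ (size OPT) > α * fromℕ (size (proj₁ (ALG m 𝓘)))
  -- The instance depends on `α` alone: `size≤` covers whatever EF1 schedule `ALG` returns on it.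
  belowThreeHalves ALG α α<3/2 = suc p , 𝓘 p , OPT p , OPT-optimal p ,
    subst (λ k → fromℕ k > α * fromℕ (size S)) (sym (size-OPT p)) (α*q<p+q α α<3/2 (size≤ p S ef1))
    where
    p : ℕ
    p = ℤ.∣ ↥ α ∣
    S : Schedule (suc p) (𝓘 p)
    S = proj₁ (ALG (suc p) (𝓘 p))
    ef1 : EF1 S
    ef1 = proj₂ (ALG (suc p) (𝓘 p))

  bound : (m : ℕ) (m≥2 : m ℕ.≥ 2) →
    Σ Instance λ 𝓘 → Instance.n 𝓘 ℕ.> 0 × Σ (Schedule m 𝓘) λ OPT →
    IsOptimal OPT ×
    ((S : Schedule m 𝓘) → EF1 S → fromℕ (size OPT) ≥ ratio m m≥2 * fromℕ (size S))
  -- The instance is nonempty because `q` is a successor.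
  bound (suc p) m≥2 = 𝓘 p , ℕ.m≤n⇒m≤o+n p ℕ.z<s , OPT p , OPT-optimal p , λ S ef1 →
    subst₂ (λ r k → r * fromℕ (size S) ≤ fromℕ k) (sym (ratio-suc p m≥2)) (sym (size-OPT p))
      (fraction*≤ (p ℕ.+ (1 ℕ.+ p ℕ.* 2)) (p ℕ.* 2) (size≤ p S ef1))
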